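{- Up to renaming of variables, the only minimally avoidable formula with exactly one fragment is $AA$.
   Context: Variables are letters of an alphabet $\Delta=\{A,B,C,\dots\}$. A formula is a finite set of non-empty words over $\Delta$, called fragments, written separated by dots; by convention every variable of a formula occurs at least twice in total (no isolated variable) and no fragment is a factor of another fragment. An occurrence of a formula $f$ in a word $w$ over an alphabet $\Sigma$ is a non-erasing morphism $h:\Delta^*\to\Sigma^*$ such that $h(\phi)$ is a factor of $w$ for every fragment $\phi$; $f$ is avoidable if for some finite alphabet there is an infinite word containing no occurrence of $f$, and unavoidable otherwise. Splitting a formula on a fragment $\phi$ means replacing $\phi$ by two fragments, namely the prefix and the suffix of $\phi$ of length $|\phi|-1$. A formula is minimally avoidable if it is avoidable and splitting it on any of its fragments yields an unavoidable formula. -}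

module Defs where

open import Data.Nat using (ℕ; _+_; _<_; _≤_; _∸_; _≟_)
open import Data.Fin using (Fin; fromℕ<)
open import Data.List using (List; []; _∷_; length; lookup; concatMap; take; drop; removeAt; filter; _++_)
open import Data.List.Relation.Unary.All using (All)
open import Data.List.Membership.Propositional using (_∈_)
open import Data.Product using (Σ; ∃; _×_)
open import Relation.Binary.PropositionalEquality using (_≡_; _≢_)
open import Relation.Nullary using (¬_)

Var : Set
Var = ℕ

Word : Set
Word = List Var

Formula : Set
Formula = List Word

InfWord : ℕ → Set
InfWord k = ℕ → Fin k

Factor : {k : ℕ} → List (Fin k) → InfWord k → Set
Factor u w = ∃ λ i → (j : ℕ) (p : j < length u) → w (i + j) ≡ lookup u (fromℕ< p)

-- A morphism Δ* → (Fin k)* is determined by images of the variables.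
Morphism : ℕ → Set
Morphism k = Var → List (Fin k)

NonErasing : {k : ℕ} → Morphism k → Set
NonErasing h = ∀ x → h x ≢ []

apply : {k : ℕ} → Morphism k → Word → List (Fin k)
apply h φ = concatMap h φ

Occurs : {k : ℕ} → Formula → InfWord k → Set
Occurs {k} f w = Σ (Morphism k) λ h → NonErasing h × All (λ φ → Factor (apply h φ) w) f

Avoidable : Formula → Set
Avoidable f = ∃ λ k → Σ (InfWord k) λ w → ¬ Occurs f w

Unavoidable : Formula → Set
Unavoidable f = ¬ Avoidable f

splitAt : (f : Formula) → Fin (length f) → Formula
splitAt f i = removeAt f i ++ (take (length φ ∸ 1) φ ∷ drop 1 φ ∷ [])
  where φ = lookup f i

MinimallyAvoidable : Formula → Set
MinimallyAvoidable f = Avoidable f × ((i : Fin (length f)) → Unavoidable (splitAt f i))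

occ : Var → Word → ℕ
occ x φ = length (filter (x ≟_) φ)

-- The one-fragment formula [ φ ] satisfies the conventions: φ is non-empty and
-- every variable of φ occurs at least twice (the no-factor condition is vacuous).
IsOneFragmentFormula : Word → Set
IsOneFragmentFormula φ = φ ≢ [] × (∀ x → x ∈ φ → 2 ≤ occ x φ)

{-# OPTIONS --safe #-}

-- Fix b ≥ 2 and let the n-th letter of a word consist of n mod b and of the residue
-- mod b² of n without its trailing base-b zeros. If a factor of length m ≥ 1 repeats
-- at distance d, then d = q b. If b ∤ q, then every position n of the factor is a
-- multiple of b, since otherwise n ≡ n + q b mod b²; hence m = 1. If b ∣ q, then the
-- multiples of b among the positions, divided by b, give a repetition of length at
-- least ⌊m / b⌋ at distance q. By induction m < 2 q, so d exceeds c m when b ≥ 2 c.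
--
-- Let V be a non-empty finite set of variables such that each x in V has a return
-- x β x, with β a word over V, in some fragment of a formula f. Given an occurrence h
-- of f, choose x in V with h x longest: two copies of h x are |h (x β)| ≤ |x β| |h x|
-- apart, which the word above excludes if c is the greatest fragment length. So f is
-- avoidable. This applies to AA with V = {A}. If φ = A ψ B is longer than AA, then
-- each x in ψ occurs once more in φ, hence has a return in Aψ or ψB whose interior is
-- a factor of ψ, so that Aψ.ψB is avoidable.
module Submission where

open import Defs
open import Data.Fin using (Fin; zero; toℕ; fromℕ<; combine)
open import Data.Fin.Properties using (combine-injective)
open import Data.List
  using (List; []; _∷_; [_]; _++_; length; lookup; filter; take; map; initLast; _∷ʳ′_)
open import Data.List.Extrema.Nat using (argmax; argmax-all; f[xs]≤f[argmax])
open import Data.List.Membership.Propositional using (_∈_; find)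
open import Data.List.Membership.Propositional.Properties using (∈-∃++; ∈-++⁺ˡ; ∈-++⁺ʳ; ∈-++⁻)
open import Data.List.Properties
  using (length-++; length-++-≤ˡ; length-++-≤ʳ; ++-assoc; concatMap-++; filter-accept)
open import Data.List.Relation.Binary.Permutation.Propositional.Properties
  using (↭-length; filter-↭; shift)
open import Data.List.Relation.Binary.Subset.Propositional using (_⊆_)
open import Data.List.Relation.Unary.All as All using (All; []; _∷_)
open import Data.List.Relation.Unary.All.Properties using (map⁺)
open import Data.List.Relation.Unary.Any using (Any; here; there)
open import Data.Nat
  using (ℕ; zero; suc; _+_; _*_; _≤_; _<_; _≟_; z≤n; s≤s; z<s; s<s; s≤s⁻¹; NonZero; >-nonZero;
         NonTrivial; nonTrivial⇒nonZero; nonTrivial⇒≢1)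
open import Data.Nat.DivMod
  using (_/_; _%_; _mod_; _divMod_; module DivMod; m%n<n; m≡m%n+[m/n]*n; m/n*n≤m)
open import Data.Nat.Divisibility
  using (_∣_; _∣?_; _∣0; divides; quotient-<; n∣m*n; ∣m+n∣m⇒∣n; *-cancelʳ-∣; ∣1⇒≡1)
open import Data.Nat.Induction using (Acc; acc; <-Rec; <-rec; <-wellFounded)
open import Data.Nat.Properties
  using (≤-refl; ≤-reflexive; ≤-trans; ≤⇒≯; <-irrefl; m≤n⇒m<n∨m≡n; n≤1+n; +-assoc; +-comm; +-suc;
         +-identityʳ; +-cancelˡ-≡; +-mono-≤; +-monoˡ-<; +-monoʳ-<; m≤m+n; m<m+n; *-assoc;
         *-distribʳ-+; *-cancelʳ-≡; *-cancelˡ-<; *-monoˡ-≤; *-monoʳ-≤; *-monoˡ-<; m≤m*n; m*n≢0;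
         m*n≡0⇒m≡0; m*n≢0⇒m≢0; module ≤-Reasoning)
open import Data.Nat.Tactic.RingSolver using (solve-∀)
open import Data.Product using (Σ; ∃; ∃₂; _×_; _,_; proj₁; proj₂)
open import Data.Sum using (inj₁; inj₂)
open import Data.Unit using (⊤; tt)
open import Function using (_∘_; id)
open import Induction.WellFounded using (module FixPoint)
open import Relation.Binary.PropositionalEquality
  using (_≡_; _≢_; refl; sym; trans; cong; subst; subst₂; module ≡-Reasoning)
open import Relation.Nullary using (¬_; yes; no; contradiction)
open import Relation.Unary using (Pred; Decidable)

mod≡⇒∣ : ∀ b .{{_ : NonZero b}} n d → n mod b ≡ (n + d) mod b → b ∣ d
mod≡⇒∣ b n d mod≡ = ∣m+n∣m⇒∣n (divides ((n + d) / b) quotients) (n∣m*n (n / b))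
  where
  open ≡-Reasoning
  quotients : n / b * b + d ≡ (n + d) / b * b
  quotients = +-cancelˡ-≡ (toℕ (n mod b)) _ _ (begin
    toℕ (n mod b) + (n / b * b + d)        ≡⟨ +-assoc (toℕ (n mod b)) (n / b * b) d ⟨
    toℕ (n mod b) + n / b * b + d          ≡⟨ cong (_+ d) (DivMod.property (n divMod b)) ⟨
    n + d                                  ≡⟨ DivMod.property ((n + d) divMod b) ⟩
    toℕ ((n + d) mod b) + (n + d) / b * b  ≡⟨ cong (λ r → toℕ r + (n + d) / b * b) mod≡ ⟨
    toℕ (n mod b) + (n + d) / b * b        ∎)

m/n<o⇒m<o*n : ∀ m n .{{_ : NonZero n}} {o} → m / n < o → m < o * n
m/n<o⇒m<o*n m n {o} m/n<o = begin-strict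
  m                  ≡⟨ m≡m%n+[m/n]*n m n ⟩
  m % n + m / n * n  <⟨ +-monoˡ-< (m / n * n) (m%n<n m n) ⟩
  suc (m / n) * n    ≤⟨ *-monoˡ-≤ n m/n<o ⟩
  o * n              ∎
  where open ≤-Reasoning

maximiser : ∀ {a} {A : Set a} (g : A → ℕ) {x xs} → x ∈ xs →
            ∃ λ y → y ∈ xs × All (λ z → g z ≤ g y) xs
maximiser g {x} {xs} x∈xs =
  argmax g x xs , argmax-all g x∈xs (All.tabulate id) , f[xs]≤f[argmax] x xs

filter-some⁻ : ∀ {a p} {A : Set a} {P : Pred A p} (P? : Decidable P) xs →
               0 < length (filter P? xs) → Any P xs
filter-some⁻ P? (x ∷ xs) 0<length with P? x
... | yes px = here px
... | no  _  = there (filter-some⁻ P? xs 0<length)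

Repeats : ∀ {a} {A : Set a} → (ℕ → A) → (i m d : ℕ) → Set a
Repeats w i m d = ∀ n → i ≤ n → n < i + m → w n ≡ w (n + d)

module Toeplitz (b : ℕ) .{{b>1 : NonTrivial b}} where

  instance
    b≢0 : NonZero b
    b≢0 = nonTrivial⇒nonZero b

    b²≢0 : NonZero (b * b)
    b²≢0 = m*n≢0 b b

  stripTrailingZerosStep : ∀ n → <-Rec (λ _ → ℕ) n → ℕ
  stripTrailingZerosStep zero      _     = zero
  stripTrailingZerosStep n@(suc _) strip with b ∣? n
  ... | yes b∣n = strip (quotient-< b∣n)
  ... | no  _   = n

  stripTrailingZerosStep-cong : ∀ n {strip strip′ : <-Rec (λ _ → ℕ) n} →
                                (∀ {m} (m<n : m < n) → strip m<n ≡ strip′ m<n) →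
                                stripTrailingZerosStep n strip ≡ stripTrailingZerosStep n strip′
  stripTrailingZerosStep-cong zero      _      = refl
  stripTrailingZerosStep-cong n@(suc _) strip≡ with b ∣? n
  ... | yes b∣n = strip≡ (quotient-< b∣n)
  ... | no  _   = refl

  stripTrailingZeros : ℕ → ℕ
  stripTrailingZeros = <-rec (λ _ → ℕ) stripTrailingZerosStep

  open FixPoint <-wellFounded (λ _ → ℕ) stripTrailingZerosStep stripTrailingZerosStep-cong
    using (unfold-wfRec)

  stripTrailingZeros-∤ : ∀ {n} → ¬ b ∣ n → stripTrailingZeros n ≡ n
  stripTrailingZeros-∤ {zero}      b∤0 = contradiction (b ∣0) b∤0
  stripTrailingZeros-∤ {n@(suc _)} b∤n = trans unfold-wfRec unstripped
    where
    unstripped : stripTrailingZerosStep n (λ {m} _ → stripTrailingZeros m) ≡ n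
    unstripped with b ∣? n
    ... | yes b∣n = contradiction b∣n b∤n
    ... | no  _   = refl

  stripTrailingZeros-* : ∀ q {n} → n ≡ q * b → stripTrailingZeros n ≡ stripTrailingZeros q
  stripTrailingZeros-* q {zero}      0≡q*b =
    cong stripTrailingZeros (sym (m*n≡0⇒m≡0 q b (sym 0≡q*b)))
  stripTrailingZeros-* q {n@(suc _)} n≡q*b = trans unfold-wfRec stripped
    where
    stripped : stripTrailingZerosStep n (λ {m} _ → stripTrailingZeros m) ≡ stripTrailingZeros q
    stripped with b ∣? n
    ... | yes (divides p n≡p*b) =
      cong stripTrailingZeros (*-cancelʳ-≡ p q b (trans (sym n≡p*b) n≡q*b))
    ... | no  b∤n = contradiction (divides q n≡q*b) b∤n

  strippedResidue : ℕ → Fin (b * b)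
  strippedResidue n = stripTrailingZeros n mod (b * b)

  strippedResidue-* : ∀ q {n} → n ≡ q * b → strippedResidue n ≡ strippedResidue q
  strippedResidue-* q n≡q*b = cong (_mod (b * b)) (stripTrailingZeros-* q n≡q*b)

  strippedResidue≡⇒∣ : ∀ n q → strippedResidue n ≡ strippedResidue (n + q * b) → ¬ b ∣ q → b ∣ n
  strippedResidue≡⇒∣ n q residue≡ b∤q with b ∣? n
  ... | yes b∣n = b∣n
  ... | no  b∤n = contradiction (*-cancelʳ-∣ b (mod≡⇒∣ (b * b) n (q * b) mod≡)) b∤q
    where
    b∤n+q*b : ¬ b ∣ n + q * b
    b∤n+q*b b∣ = b∤n (∣m+n∣m⇒∣n (subst (b ∣_) (+-comm n (q * b)) b∣) (n∣m*n q))

    mod≡ : n mod (b * b) ≡ (n + q * b) mod (b * b)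
    mod≡ = subst₂ (λ r s → r mod (b * b) ≡ s mod (b * b))
      (stripTrailingZeros-∤ b∤n) (stripTrailingZeros-∤ b∤n+q*b) residue≡

  repeats-∤⇒≤1 : ∀ {q i} m → ¬ b ∣ q → Repeats strippedResidue i m (q * b) → m ≤ 1
  repeats-∤⇒≤1         zero          _   _   = z≤n
  repeats-∤⇒≤1         (suc zero)    _   _   = ≤-refl
  repeats-∤⇒≤1 {q} {i} (suc (suc m)) b∤q rep =
    contradiction (∣1⇒≡1 (∣m+n∣m⇒∣n b∣i+1 b∣i)) nonTrivial⇒≢1
    where
    b∣i : b ∣ i
    b∣i = strippedResidue≡⇒∣ i q (rep i ≤-refl (m<m+n i z<s)) b∤q

    b∣i+1 : b ∣ i + 1
    b∣i+1 = strippedResidue≡⇒∣ (i + 1) q (rep (i + 1) (m≤m+n i 1) (+-monoʳ-< i (s<s z<s))) b∤q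

  repeats-coarsen : ∀ {q i m} → Repeats strippedResidue (suc i) m (q * b) →
                    Repeats strippedResidue (suc (i / b)) (m / b) q
  repeats-coarsen {q} {i} {m} rep n i/b<n n<1+i/b+m/b = begin
    strippedResidue n                ≡⟨ strippedResidue-* n refl ⟨
    strippedResidue (n * b)          ≡⟨ rep (n * b) (m/n<o⇒m<o*n i b i/b<n) (s≤s n*b≤i+m) ⟩
    strippedResidue (n * b + q * b)  ≡⟨ strippedResidue-* (n + q) (sym (*-distribʳ-+ b n q)) ⟩
    strippedResidue (n + q)          ∎
    where
    n*b≤i+m : n * b ≤ i + m
    n*b≤i+m = begin
      n * b                  ≤⟨ *-monoˡ-≤ b (s≤s⁻¹ n<1+i/b+m/b) ⟩
      (i / b + m / b) * b    ≡⟨ *-distribʳ-+ b (i / b) (m / b) ⟩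
      i / b * b + m / b * b  ≤⟨ +-mono-≤ (m/n*n≤m i b) (m/n*n≤m m b) ⟩
      i + m                  ∎
      where open ≤-Reasoning

    open ≡-Reasoning

  repeats⇒<2* : ∀ {q} → Acc _<_ q → .{{NonZero q}} → ∀ {i m} →
                Repeats strippedResidue (suc i) m (q * b) → m < 2 * q
  repeats⇒<2* {q} (acc rs) {i} {m} rep with b ∣? q
  ... | no  b∤q                  = ≤-trans (s≤s (repeats-∤⇒≤1 m b∤q rep)) (m≤m*n 2 q)
  ... | yes b∣q@(divides p refl) = subst (m <_) (*-assoc 2 p b)
    (m/n<o⇒m<o*n m b (repeats⇒<2* (rs (quotient-< b∣q)) (repeats-coarsen rep)))
    where instance _ = m*n≢0⇒m≢0 p

  -- Positions are numbered from 1, so that the multiples of b after i are the n * b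
  -- with n > i / b.
  word : InfWord (b * (b * b))
  word n = combine (suc n mod b) (strippedResidue (suc n))

  word-≡⁻ : ∀ m n → word m ≡ word n →
            suc m mod b ≡ suc n mod b × strippedResidue (suc m) ≡ strippedResidue (suc n)
  word-≡⁻ m n = combine-injective (suc m mod b) _ (suc n mod b) _

  word-repeats⇒< : ∀ i m d → 0 < m → 0 < d → Repeats word i m d → m * b < 2 * d
  word-repeats⇒< i m d 0<m 0<d rep
    with mod≡⇒∣ b (suc i) d (proj₁ (word-≡⁻ i (i + d) (rep i ≤-refl (m<m+n i 0<m))))
  ... | divides q refl = subst (m * b <_) (*-assoc 2 q b) (*-monoˡ-< b m<2q)
    where
    instance
      q≢0 : NonZero q
      q≢0 = m*n≢0⇒m≢0 q {{>-nonZero 0<d}}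

    residue-repeats : Repeats strippedResidue (suc i) m (q * b)
    residue-repeats (suc n) (s≤s i≤n) (s≤s n<i+m) =
      proj₂ (word-≡⁻ n (n + q * b) (rep n i≤n n<i+m))

    m<2q : m < 2 * q
    m<2q = repeats⇒<2* (<-wellFounded q) residue-repeats

Sparse : {k : ℕ} → ℕ → InfWord k → Set
Sparse c w = ∀ i m d → 0 < m → 0 < d → Repeats w i m d → c * m < d

sparse-word : ∀ c → ∃ λ k → Σ (InfWord k) (Sparse c)
sparse-word c = _ , word , λ i m d 0<m 0<d rep → *-cancelˡ-< 2 (c * m) d (begin-strict
  2 * (c * m)      ≤⟨ *-monoʳ-≤ 2 (*-monoˡ-≤ m (n≤1+n c)) ⟩
  2 * (suc c * m)  ≡⟨ rearrange c m ⟩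
  m * (suc c * 2)  <⟨ word-repeats⇒< i m d 0<m 0<d rep ⟩
  2 * d            ∎)
  where
  open Toeplitz (suc c * 2)
  open ≤-Reasoning
  rearrange : ∀ c m → 2 * (suc c * m) ≡ m * (suc c * 2)
  rearrange = solve-∀

OccursAt : {k : ℕ} → InfWord k → List (Fin k) → ℕ → Set
OccursAt w []      i = ⊤
OccursAt w (a ∷ u) i = w i ≡ a × OccursAt w u (suc i)

factor⇒occursAt : ∀ {k} {w : InfWord k} {u} → Factor u w → ∃ (OccursAt w u)
factor⇒occursAt {w = w} (i , factor) = i , lookup⇒occursAt _ i factor
  where
  lookup⇒occursAt : ∀ u i → (∀ j (j< : j < length u) → w (i + j) ≡ lookup u (fromℕ< j<)) →
                    OccursAt w u i
  lookup⇒occursAt []      i eq = tt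
  lookup⇒occursAt (a ∷ u) i eq =
    trans (cong w (sym (+-identityʳ i))) (eq 0 z<s) ,
    lookup⇒occursAt u (suc i) λ j j< → trans (cong w (sym (+-suc i j))) (eq (suc j) (s<s j<))

occursAt-++⁻ : ∀ {k} {w : InfWord k} u {v} i →
               OccursAt w (u ++ v) i → OccursAt w u i × OccursAt w v (i + length u)
occursAt-++⁻ []          i at = tt , subst (OccursAt _ _) (sym (+-identityʳ i)) at
occursAt-++⁻ (a ∷ u) {v} i (wᵢ≡a , at) with occursAt-++⁻ u (suc i) at
... | atᵤ , atᵥ = (wᵢ≡a , atᵤ) , subst (OccursAt _ v) (sym (+-suc i (length u))) atᵥ

occursAt⇒repeats : ∀ {k} {w : InfWord k} u i d →
                   OccursAt w u i → OccursAt w u (i + d) → Repeats w i (length u) d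
occursAt⇒repeats []      i d _ _ n i≤n n<i =
  contradiction (subst (n <_) (+-identityʳ i) n<i) (≤⇒≯ i≤n)
occursAt⇒repeats (a ∷ u) i d (wᵢ≡a , at) (wᵢ₊ᵈ≡a , at′) n i≤n n<i+m with m≤n⇒m<n∨m≡n i≤n
... | inj₂ refl = trans wᵢ≡a (sym wᵢ₊ᵈ≡a)
... | inj₁ i<n  =
  occursAt⇒repeats u (suc i) d at at′ n i<n (subst (n <_) (+-suc i (length u)) n<i+m)

sparse-copies-apart : ∀ {k c} {w : InfWord k} → Sparse c w → ∀ s u v {t} → u ≢ [] →
                      Factor (s ++ (u ++ v) ++ u ++ t) w → c * length u < length (u ++ v)
sparse-copies-apart sparse s []        v u≢[] factor = contradiction refl u≢[]
sparse-copies-apart sparse s u@(_ ∷ _) v u≢[] factor =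
  let i      , at      = factor⇒occursAt factor
      _      , at-uvut = occursAt-++⁻ s i at
      at-uv  , at-ut   = occursAt-++⁻ (u ++ v) _ at-uvut
      first  , _       = occursAt-++⁻ u _ at-uv
      second , _       = occursAt-++⁻ u _ at-ut
  in sparse _ (length u) _ z<s z<s (occursAt⇒repeats u _ _ first second)

length-apply-≤ : ∀ {k} (h : Morphism k) {m} φ → All (λ y → length (h y) ≤ m) φ →
                 length (apply h φ) ≤ length φ * m
length-apply-≤ h []      []          = z≤n
length-apply-≤ h (y ∷ φ) (y≤m ∷ φ≤m) =
  ≤-trans (≤-reflexive (length-++ (h y))) (+-mono-≤ y≤m (length-apply-≤ h φ φ≤m))

HasReturn : List Var → Var → Word → Set
HasReturn V x φ = ∃₂ λ α β → ∃ λ γ → β ⊆ V × φ ≡ α ++ (x ∷ β) ++ x ∷ γ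

Recurrent : List Var → Formula → Set
Recurrent V f = All (λ x → Any (HasReturn V x) f) V

sparse-avoids-return : ∀ {k c} {w : InfWord k} {h : Morphism k} → Sparse c w → NonErasing h →
                       ∀ α x β {γ} → length (x ∷ β) ≤ c →
                       All (λ y → length (h y) ≤ length (h x)) β →
                       ¬ Factor (apply h (α ++ (x ∷ β) ++ x ∷ γ)) w
sparse-avoids-return {c = c} {w} {h} sparse h≢[] α x β {γ} xβ≤c longest factor =
  <-irrefl refl (begin-strict
    c * length (h x)               <⟨ copies-apart ⟩
    length (apply h (x ∷ β))       ≤⟨ length-apply-≤ h (x ∷ β) (≤-refl ∷ longest) ⟩
    length (x ∷ β) * length (h x)  ≤⟨ *-monoˡ-≤ (length (h x)) xβ≤c ⟩
    c * length (h x)               ∎)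
  where
  open ≤-Reasoning
  image : Factor (apply h α ++ apply h (x ∷ β) ++ apply h (x ∷ γ)) w
  image = subst (λ u → Factor u w)
    (trans (concatMap-++ h α _) (cong (apply h α ++_) (concatMap-++ h (x ∷ β) (x ∷ γ)))) factor

  copies-apart : c * length (h x) < length (apply h (x ∷ β))
  copies-apart = sparse-copies-apart {c = c} sparse (apply h α) (h x) (apply h β) (h≢[] x) image

sparse-avoids-recurrent : ∀ {k c} {w : InfWord k} {V f x} → Sparse c w →
                          All (λ φ → length φ ≤ c) f → x ∈ V → Recurrent V f → ¬ Occurs f w
sparse-avoids-recurrent sparse f≤c x∈V recurrent (h , h≢[] , occurs)
  with maximiser (length ∘ h) x∈V
... | y , y∈V , longest with find (All.lookup recurrent y∈V)
...   | _ , φ∈f , α , β , γ , β⊆V , refl =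
  sparse-avoids-return sparse h≢[] α y β
    (≤-trans yβ≤φ (All.lookup f≤c φ∈f))
    (All.tabulate (All.lookup longest ∘ β⊆V))
    (All.lookup occurs φ∈f)
  where
  yβ≤φ : length (y ∷ β) ≤ length (α ++ (y ∷ β) ++ y ∷ γ)
  yβ≤φ = ≤-trans (length-++-≤ˡ (y ∷ β)) (length-++-≤ʳ ((y ∷ β) ++ y ∷ γ) {α})

recurrent⇒avoidable : ∀ {V f x} → x ∈ V → Recurrent V f → Avoidable f
recurrent⇒avoidable x∈V recurrent with find (All.lookup recurrent x∈V)
... | _ , χ∈f , _ with maximiser length χ∈f
...   | φ , _ , f≤φ with sparse-word (length φ)
...     | k , w , sparse = k , w , sparse-avoids-recurrent sparse f≤φ x∈V recurrent

letters-unavoidable : ∀ xs → Unavoidable (map [_] xs)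
letters-unavoidable xs (k , w , avoids) =
  avoids ((λ _ → [ w 0 ]) , (λ _ ()) , map⁺ (All.universal (λ _ → first-letter) xs))
  where
  first-letter : Factor [ w 0 ] w
  first-letter = 0 , λ where
    zero    _        → refl
    (suc _) (s≤s ())

occ-insert : ∀ x φ χ → occ x (φ ++ x ∷ χ) ≡ suc (occ x (φ ++ χ))
occ-insert x φ χ = trans (↭-length (filter-↭ (x ≟_) (shift x φ χ)))
  (cong length (filter-accept (x ≟_) refl))

2≤occ⇒∈ : ∀ x φ χ → 2 ≤ occ x (φ ++ x ∷ χ) → x ∈ φ ++ χ
2≤occ⇒∈ x φ χ 2≤occ =
  filter-some⁻ (x ≟_) (φ ++ χ) (s≤s⁻¹ (subst (2 ≤_) (occ-insert x φ χ) 2≤occ))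

splitAt-single : ∀ A ψ B → splitAt ((A ∷ ψ ++ [ B ]) ∷ []) zero ≡ (A ∷ ψ) ∷ (ψ ++ [ B ]) ∷ []
splitAt-single A ψ B = cong (_∷ (ψ ++ [ B ]) ∷ []) (take-init A ψ)
  where
  take-init : ∀ A ψ → take (length (ψ ++ [ B ])) (A ∷ ψ ++ [ B ]) ≡ A ∷ ψ
  take-init A []      = refl
  take-init A (C ∷ ψ) = cong (A ∷_) (take-init C ψ)

hasReturn-earlier : ∀ {A ψ χ x} → x ∈ A ∷ ψ → HasReturn (ψ ++ x ∷ χ) x (A ∷ ψ ++ x ∷ χ)
hasReturn-earlier {ψ = ψ} {χ} (here refl) = [] , ψ , χ , ∈-++⁺ˡ , refl
hasReturn-earlier {A} {χ = χ} {x} (there x∈ψ) with ∈-∃++ x∈ψ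
... | α , β , refl =
  A ∷ α , β , χ , ∈-++⁺ˡ ∘ ∈-++⁺ʳ α ∘ there , cong (A ∷_) (++-assoc α (x ∷ β) (x ∷ χ))

hasReturn-later : ∀ ψ χ {B x} → x ∈ χ ++ [ B ] → HasReturn (ψ ++ x ∷ χ) x (ψ ++ x ∷ χ ++ [ B ])
hasReturn-later ψ χ {B} {x} x∈χB with ∈-++⁻ χ x∈χB
... | inj₂ (here refl) = ψ , χ , [] , ∈-++⁺ʳ ψ ∘ there , refl
... | inj₁ x∈χ with ∈-∃++ x∈χ
...   | β , γ , refl =
  ψ , β , γ ++ [ B ] , ∈-++⁺ʳ ψ ∘ there ∘ ∈-++⁺ˡ ,
  cong (λ ω → ψ ++ x ∷ ω) (++-assoc β (x ∷ γ) [ B ])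

inner-hasReturn : ∀ {A ψ B x} → x ∈ ψ → 2 ≤ occ x (A ∷ ψ ++ [ B ]) →
                  Any (HasReturn ψ x) ((A ∷ ψ) ∷ (ψ ++ [ B ]) ∷ [])
inner-hasReturn {A} {_} {B} {x} x∈ψ 2≤occ with ∈-∃++ x∈ψ
... | ψ₁ , ψ₂ , refl rewrite ++-assoc ψ₁ (x ∷ ψ₂) [ B ]
  with ∈-++⁻ (A ∷ ψ₁) (2≤occ⇒∈ x (A ∷ ψ₁) (ψ₂ ++ [ B ]) 2≤occ)
...   | inj₁ x∈Aψ₁ = here (hasReturn-earlier x∈Aψ₁)
...   | inj₂ x∈ψ₂B = there (here (hasReturn-later ψ₁ ψ₂ x∈ψ₂B))

split-avoidable : ∀ {A ψ B x} → x ∈ ψ → (∀ {y} → y ∈ ψ → 2 ≤ occ y (A ∷ ψ ++ [ B ])) →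
                  Avoidable (splitAt ((A ∷ ψ ++ [ B ]) ∷ []) zero)
split-avoidable {A} {ψ} {B} x∈ψ twice = subst Avoidable (sym (splitAt-single A ψ B))
  (recurrent⇒avoidable x∈ψ (All.tabulate λ y∈ψ → inner-hasReturn y∈ψ (twice y∈ψ)))

minimal⇒square : ∀ φ → IsOneFragmentFormula φ → MinimallyAvoidable (φ ∷ []) →
                 ∃ λ A → φ ≡ A ∷ A ∷ []
minimal⇒square []      (φ≢[] , _)  _             = contradiction refl φ≢[]
minimal⇒square (A ∷ φ) (_ , twice) (_ , minimal) with initLast φ
... | [] = contradiction (2≤occ⇒∈ A [] [] (twice A (here refl))) λ ()
... | (C ∷ ψ) ∷ʳ′ B =
  contradiction (split-avoidable (here refl) λ y∈Cψ → twice _ (there (∈-++⁺ˡ y∈Cψ))) (minimal zero)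
... | [] ∷ʳ′ B with 2≤occ⇒∈ A [] [ B ] (twice A (here refl))
...   | here refl = A , refl

square-minimal : ∀ A → MinimallyAvoidable ((A ∷ A ∷ []) ∷ [])
square-minimal A =
  recurrent⇒avoidable {V = [ A ]} (here refl) (here ([] , [] , [] , (λ ()) , refl) ∷ []) ,
  λ { zero → letters-unavoidable (A ∷ A ∷ []) }

theorem8 : (φ : Word) → IsOneFragmentFormula φ →
    (MinimallyAvoidable (φ ∷ []) → ∃ λ A → φ ≡ A ∷ A ∷ []) ×
    ((∃ λ A → φ ≡ A ∷ A ∷ []) → MinimallyAvoidable (φ ∷ []))
theorem8 φ one = minimal⇒square φ one , λ where
  (A , refl) → square-minimal A
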